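{- Let $n\ge 2$ and let $\Gamma\cup\{\varphi\}\subseteq For(\Sigma^{C_1}_D)$. Then $\Gamma\vdash_{C^D_n}\varphi$ only if $\Gamma\vDash_{C^D_n}\varphi$.
   Context: **Syntax.** $For(\Sigma^{C_1}_D)$ is the set of formulas generated from a denumerable set of propositional variables by the signature $\Sigma^{C_1}_D=\{\to,\neg,\lor,\land,\mathsf{O}\}$ ($\neg,\mathsf{O}$ unary; $\to,\lor,\land$ binary). Abbreviations: $\alpha^0:=\alpha$; $\alpha^{k+1}:=\neg(\alpha^k\land\neg\alpha^k)$; $\alpha^{(n)}:=\alpha^1\land\dots\land\alpha^n$; ${\sim}^{(n)}\alpha:=\neg\alpha\land\alpha^{(n)}$. **The logic $C^D_n$.** Hilbert calculus whose axiom schemas are those of $CPL^+$, the positive fragment of classical propositional logic in $\to,\land,\lor$ (for instance: $\alpha\to(\beta\to\alpha)$; $(\alpha\to(\beta\to\gamma))\to((\alpha\to\beta)\to(\alpha\to\gamma))$; $\alpha\to(\beta\to(\alpha\land\beta))$; $(\alpha\land\beta)\to\alpha$; $(\alpha\land\beta)\to\beta$; $\alpha\to(\alpha\lor\beta)$; $\beta\to(\alpha\lor\beta)$; $(\alpha\to\gamma)\to((\beta\to\gamma)\to((\alpha\lor\beta)\to\gamma))$; $\alpha\lor(\alpha\to\beta)$), plus - (EM) $\alpha\lor\neg\alpha$; (cf) $\neg\neg\alpha\to\alpha$; - (bc$_n$) $\alpha^{(n)}\to(\alpha\to(\neg\alpha\to\beta))$; - (P$_n$) $(\alpha^{(n)}\land\beta^{(n)})\to((\alpha\to\beta)^{(n)}\land(\alpha\lor\beta)^{(n)}\land(\alpha\land\beta)^{(n)})$;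 - (K) $\mathsf{O}(\alpha\to\beta)\to(\mathsf{O}\alpha\to\mathsf{O}\beta)$; - (D$_n$) $\mathsf{O}\alpha\to{\sim}^{(n)}\mathsf{O}{\sim}^{(n)}\alpha$; - (P$\mathsf{O}_n$) $\alpha^{(n)}\to(\mathsf{O}\alpha)^{(n)}$. The rules are Modus Ponens and $\mathsf{O}$-necessitation (from $\varphi$ infer $\mathsf{O}\varphi$). $\vdash_{C^D_n}\varphi$ means that there is a finite derivation of $\varphi$ from axioms (no premises) using the rules. $\Gamma\vdash_{C^D_n}\varphi$ means: either $\vdash_{C^D_n}\varphi$, or there are $\gamma_1,\dots,\gamma_k\in\Gamma$ ($k\ge1$ finite) with $\vdash_{C^D_n}(\gamma_1\land\dots\land\gamma_k)\to\varphi$. **Truth values.** $A_n=\{z\in\{0,1\}^{n+1}: (\bigwedge_{i\le k}z_i)\lor z_{k+1}=1\text{ for every }1\le k\le n\}$. It has exactly $n+2$ elements: $T_n=(1,0,1,\dots,1)$; $F_n=(0,1,\dots,1)$; for $0\le i\le n-2$, $t^n_i$ is the tuple whose only $0$ is in position $i+3$; and $t^n_{n-1}=(1,\dots,1)$. Put $D_n=A_n\setminus\{F_n\}$, $I_n=A_n\setminus\{T_n,F_n\}$, $Boo_n=\{T_n,F_n\}$. **Multioperations.** With $\sqcap,\sqcup,\supset$ the Boolean meet, join, implication on $\{0,1\}$ and $\bigwedge$ the meet of a non-empty subset of $\{0,1\}$, for $a,b\in A_n$ and $\emptyset\ne X\subseteq A_n$: - $\tilde\neg a=\{c\in A_n: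 c_1=a_2\text{ and }c_2\le a_1\}$; - for $\#\in\{\land,\lor,\to\}$ with corresponding Boolean operation $\ast\in\{\sqcap,\sqcup,\supset\}$: $a\,\tilde\#\,b=\{c\in Boo_n:c_1=a_1\ast b_1\}$ if $a,b\in Boo_n$, and $a\,\tilde\#\,b=\{c\in A_n:c_1=a_1\ast b_1\}$ otherwise; - $\tilde{\mathsf{O}}(X)=\{c\in A_n:c_1=\bigwedge\{x_1:x\in X\}\}$. **Models.** A swap Kripke model for $C^D_n$ is a triple $(W,R,\{v^n_w\}_{w\in W})$ with $W\neq\emptyset$, $R\subseteq W\times W$ serial (every $w$ has some $w'$ with $wRw'$), and functions $v^n_w:For(\Sigma^{C_1}_D)\to A_n$ such that for all $\alpha,\beta$ and $w$: - $v^n_w(\neg\alpha)\in\tilde\neg v^n_w(\alpha)$; $v^n_w(\alpha\#\beta)\in v^n_w(\alpha)\,\tilde\#\,v^n_w(\beta)$ for $\#\in\{\land,\lor,\to\}$; $v^n_w(\mathsf{O}\alpha)\in\tilde{\mathsf{O}}(\{v^n_{w'}(\alpha):wRw'\})$; - $v^n_w(\alpha)=t^n_0$ implies $v^n_w(\alpha\land\neg\alpha)=T_n$; - for $1\le k\le n-1$: $v^n_w(\alpha)=t^n_k$ implies $v^n_w(\alpha\land\neg\alpha)\in I_n$ and $v^n_w(\alpha^1)=t^n_{k-1}$; - if $v^n_w(\alpha)\in Boo_n$ then $v^n_w(\mathsf{O}\alpha)\in Boo_n$. $\mathcal{M},w\vDash\alpha$ means $v^n_w(\alpha)\in D_n$;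 $\mathcal{M},w\vDash\Gamma$ means $\mathcal{M},w\vDash\gamma$ for all $\gamma\in\Gamma$. $\Gamma\vDash_{C^D_n}\alpha$ means: for every swap Kripke model $\mathcal{M}$ for $C^D_n$ and every world $w$ in it, $\mathcal{M},w\vDash\Gamma$ implies $\mathcal{M},w\vDash\alpha$. -}

module Defs where

open import Level using (Level; _⊔_) renaming (suc to lsuc)
open import Data.Bool.Base as Bool using (Bool; true; false; not; if_then_else_)
import Data.Bool.Properties as Boolₚ
open import Data.Fin.Base using (Fin; zero; suc; toℕ; fromℕ<; inject₁)
open import Data.List.NonEmpty.Base using (List⁺; foldl₁)
open import Data.List.NonEmpty.Relation.Unary.All using (All)
open import Data.Nat.Base using (ℕ; zero; suc; _≤_; _∸_; _≡ᵇ_)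
open import Data.Nat.Properties using (m≤n⇒m≤1+n)
open import Data.Product.Base using (_×_; ∃; ∃-syntax; _,_)
open import Data.Sum.Base using (_⊎_)
open import Data.Vec.Base using (Vec; []; _∷_; lookup; tabulate)
open import Data.Vec.Properties using (≡-dec)
open import Relation.Binary.Core using (Rel)
open import Relation.Binary.PropositionalEquality using (_≡_)
open import Relation.Nullary.Decidable using (⌊_⌋; _×-dec_; _⊎-dec_)
open import Relation.Unary using (Pred; Decidable; _∈_; _∪_; _∖_; ｛_｝)

------------------------------------------------------------------------
-- Syntax

infix  8 ¬_ O_
infixl 7 _∧_
infixl 6 _∨_
infixr 5 _⇒_

data Formula : Set where
  var         : ℕ → Formula
  ¬_ O_       : Formula → Formula
  _∧_ _∨_ _⇒_ : Formula → Formula → Formula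

infix 9 _^_ _⁽_⁾

_^_ : Formula → ℕ → Formula
α ^ zero  = α
α ^ suc k = ¬ (α ^ k ∧ ¬ (α ^ k))

-- α ^ 1 ∧ … ∧ α ^ n, bracketed to the left.  It is meant for n ≥ 1 only;
-- the value at 0 is a dummy.
_⁽_⁾ : Formula → ℕ → Formula
α ⁽ zero ⁾        = α ^ 1
α ⁽ suc zero ⁾    = α ^ 1
α ⁽ suc (suc n) ⁾ = α ⁽ suc n ⁾ ∧ α ^ suc (suc n)

∼[_]_ : ℕ → Formula → Formula
∼[ n ] α = ¬ α ∧ α ⁽ n ⁾

⋀⁺ : List⁺ Formula → Formula
⋀⁺ = foldl₁ _∧_

------------------------------------------------------------------------
-- The Hilbert calculus

data Axiom (n : ℕ) : Formula → Set where
  ax-K    : ∀ α β   → Axiom n (α ⇒ (β ⇒ α))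
  ax-S    : ∀ α β γ → Axiom n ((α ⇒ (β ⇒ γ)) ⇒ ((α ⇒ β) ⇒ (α ⇒ γ)))
  ax-∧I   : ∀ α β   → Axiom n (α ⇒ (β ⇒ α ∧ β))
  ax-∧E₁  : ∀ α β   → Axiom n (α ∧ β ⇒ α)
  ax-∧E₂  : ∀ α β   → Axiom n (α ∧ β ⇒ β)
  ax-∨I₁  : ∀ α β   → Axiom n (α ⇒ α ∨ β)
  ax-∨I₂  : ∀ α β   → Axiom n (β ⇒ α ∨ β)
  ax-∨E   : ∀ α β γ → Axiom n ((α ⇒ γ) ⇒ ((β ⇒ γ) ⇒ (α ∨ β ⇒ γ)))
  ax-∨⇒   : ∀ α β   → Axiom n (α ∨ (α ⇒ β))
  ax-EM   : ∀ α     → Axiom n (α ∨ ¬ α)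
  ax-cf   : ∀ α     → Axiom n (¬ ¬ α ⇒ α)
  ax-bc   : ∀ α β   → Axiom n (α ⁽ n ⁾ ⇒ (α ⇒ (¬ α ⇒ β)))
  ax-P    : ∀ α β   → Axiom n (α ⁽ n ⁾ ∧ β ⁽ n ⁾ ⇒
                         (α ⇒ β) ⁽ n ⁾ ∧ (α ∨ β) ⁽ n ⁾ ∧ (α ∧ β) ⁽ n ⁾)
  ax-OK   : ∀ α β   → Axiom n (O (α ⇒ β) ⇒ (O α ⇒ O β))
  ax-OD   : ∀ α     → Axiom n (O α ⇒ ∼[ n ] (O (∼[ n ] α)))
  ax-PO   : ∀ α     → Axiom n (α ⁽ n ⁾ ⇒ (O α) ⁽ n ⁾)

data Theorem (n : ℕ) : Formula → Set where
  axiom : ∀ {α}   → Axiom n α → Theorem n α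
  mp    : ∀ {α β} → Theorem n (α ⇒ β) → Theorem n α → Theorem n β
  nec   : ∀ {α}   → Theorem n α → Theorem n (O α)

infix 4 _⊢[_]_

_⊢[_]_ : ∀ {ℓ} → Pred Formula ℓ → ℕ → Formula → Set ℓ
Γ ⊢[ n ] φ = Theorem n φ
           ⊎ ∃[ γs ] (All (_∈ Γ) γs × Theorem n (⋀⁺ γs ⇒ φ))

------------------------------------------------------------------------
-- Operations on {0,1}

infixr 5 _⊃_

_⊃_ : Bool → Bool → Bool
x ⊃ y = not x Bool.∨ y

-- m is the meet (greatest lower bound) of S.  It is given as a relation
-- because the meet of an arbitrary S is not computable.
IsMeet : ∀ {ℓ} → Pred Bool ℓ → Bool → Set ℓ
IsMeet S m = (∀ {x} → x ∈ S → m Bool.≤ x)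
           × (∀ b → (∀ {x} → x ∈ S → b Bool.≤ x) → b Bool.≤ m)

-- The meet of the entries with (0-based) index at most i.
prefixMeet : ∀ {m} → Vec Bool m → Fin m → Bool
prefixMeet (x ∷ xs) zero    = x
prefixMeet (x ∷ xs) (suc i) = x Bool.∧ prefixMeet xs i

------------------------------------------------------------------------
-- Truth values, multioperations and models

module Swap (n : ℕ) (2≤n : 2 ≤ n) where

  Tuple : Set
  Tuple = Vec Bool (suc n)

  -- The coordinates written z₁ and z₂ in 1-based notation.
  π₁ π₂ : Tuple → Bool
  π₁ z = lookup z zero
  π₂ z = lookup z (fromℕ< (m≤n⇒m≤1+n 2≤n))

  -- With 1-based positions: (z₁ ⊓ … ⊓ zₖ) ⊔ zₖ₊₁ = 1 for 1 ≤ k ≤ n;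
  -- here i is k - 1.
  A : Pred Tuple _
  A z = ∀ (i : Fin n) → prefixMeet z (inject₁ i) Bool.∨ lookup z (suc i) ≡ true

  -- The tuple whose only 0 is at the (0-based) index p, and the all-ones
  -- tuple if p > n.
  zeroAt : ℕ → Tuple
  zeroAt p = tabulate λ i → not (toℕ i ≡ᵇ p)

  T F : Tuple
  T = zeroAt 1
  F = zeroAt 0

  -- t i is meant for i ≤ n - 1; in particular t (n - 1) is all ones.
  t : ℕ → Tuple
  t i = zeroAt (suc (suc i))

  Boo D I : Pred Tuple _
  Boo = ｛ T ｝ ∪ ｛ F ｝
  D   = A ∖ ｛ F ｝
  I   = A ∖ Boo

  Boo? : Decidable Boo
  Boo? z = ≡-dec Boolₚ._≟_ T z ⊎-dec ≡-dec Boolₚ._≟_ F z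

  ¬̃ : Tuple → Pred Tuple _
  ¬̃ a c = c ∈ A × π₁ c ≡ π₂ a × π₂ c Bool.≤ π₁ a

  binary : (Bool → Bool → Bool) → Tuple → Tuple → Pred Tuple _
  binary _*_ a b =
    if ⌊ Boo? a ×-dec Boo? b ⌋
    then (λ c → c ∈ Boo × π₁ c ≡ π₁ a * π₁ b)
    else (λ c → c ∈ A   × π₁ c ≡ π₁ a * π₁ b)

  _∧̃_ _∨̃_ _⇒̃_ : Tuple → Tuple → Pred Tuple _
  _∧̃_ = binary Bool._∧_
  _∨̃_ = binary Bool._∨_
  _⇒̃_ = binary _⊃_

  Õ : ∀ {ℓ} → Pred Tuple ℓ → Pred Tuple ℓ
  Õ X c = c ∈ A × IsMeet (λ b → ∃[ x ] (x ∈ X × b ≡ π₁ x)) (π₁ c)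

  record Model (w r : Level) : Set (lsuc (w ⊔ r)) where
    infix 4 _R_
    field
      World     : Set w
      inhabited : World
      _R_       : Rel World r
      serial    : ∀ u → ∃[ u′ ] u R u′
      v         : World → Formula → Tuple
      v∈A       : ∀ u α → v u α ∈ A
      v-¬       : ∀ u α → v u (¬ α) ∈ ¬̃ (v u α)
      v-∧       : ∀ u α β → v u (α ∧ β) ∈ (v u α ∧̃ v u β)
      v-∨       : ∀ u α β → v u (α ∨ β) ∈ (v u α ∨̃ v u β)
      v-⇒       : ∀ u α β → v u (α ⇒ β) ∈ (v u α ⇒̃ v u β)
      v-O       : ∀ u α → v u (O α) ∈ Õ (λ x → ∃[ u′ ] (u R u′ × x ≡ v u′ α))
      v-t₀      : ∀ u α → v u α ≡ t 0 → v u (α ∧ ¬ α) ≡ T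
      v-tₖ      : ∀ u α k → 1 ≤ k → k ≤ n ∸ 1 → v u α ≡ t k →
                  v u (α ∧ ¬ α) ∈ I × v u (α ^ 1) ≡ t (k ∸ 1)
      v-Boo     : ∀ u α → v u α ∈ Boo → v u (O α) ∈ Boo

  infix 4 _,_⊨_ _,_⊨*_

  _,_⊨_ : ∀ {w r} (M : Model w r) → Model.World M → Formula → Set
  M , u ⊨ α = Model.v M u α ∈ D

  _,_⊨*_ : ∀ {w r ℓ} (M : Model w r) → Model.World M → Pred Formula ℓ → Set ℓ
  M , u ⊨* Γ = ∀ {γ} → γ ∈ Γ → M , u ⊨ γ

  -- Consequence over all models whose worlds and accessibility relation
  -- live in the universes w and r.
  Entails : ∀ (w r : Level) {ℓ} → Pred Formula ℓ → Formula → Set (lsuc (w ⊔ r) ⊔ ℓ)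
  Entails w r Γ φ = ∀ (M : Model w r) u → M , u ⊨* Γ → M , u ⊨ φ

{-# OPTIONS --safe #-}
module Submission where

-- A tuple in A has at most one 0, so z₁ = 0 singles out F and z₂ = 0 singles
-- out T.  Hence designation is the first coordinate, which behaves classically
-- under ∧, ∨, ⇒ and as the meet over successors under O.  The key point is that
-- α ⁽ n ⁾ holds exactly when α takes a value in Boo: from T or F every α ^ k
-- with k ≥ 1 has value T, while from t k the values of α ^ 1, α ^ 2, … go down
-- through t (k - 1), …, t 0 and reach F at α ^ (k + 1), where k + 1 ≤ n.
-- Consequently ∼[ n ] is classical negation, and soundness follows by induction
-- on derivations.

open import Defs
open import Level using (Level)
open import Data.Bool.Base as Bool using (Bool; true; false; not; b≤b)
import Data.Bool.Properties as Boolₚ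
open import Data.Empty using (⊥; ⊥-elim)
open import Data.Fin.Base as Fin using (Fin; zero; suc; toℕ; inject₁)
import Data.Fin.Properties as Finₚ
open import Data.List.Base using ([]; _∷_)
open import Data.List.NonEmpty.Base using (_∷_)
open import Data.List.NonEmpty.Relation.Unary.All using (_∷_)
open import Data.List.Relation.Unary.All as List using ([]; _∷_)
open import Data.Nat.Base using (ℕ; zero; suc; _≤_; _<_; z≤n; s≤s; _∸_; _≡ᵇ_)
import Data.Nat.Properties as ℕₚ
open import Data.Product.Base using (_×_; ∃-syntax; _,_; proj₁; proj₂)
open import Data.Sum.Base using (_⊎_; inj₁; inj₂; [_,_]′)
open import Data.Vec.Base using (Vec; _∷_; lookup)
import Data.Vec.Properties as Vecₚ
open import Function.Base using (_∘_)
open import Relation.Binary.Definitions using (tri<; tri≈; tri>)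
open import Relation.Binary.PropositionalEquality
open import Relation.Nullary using (yes; no; contradiction)
open import Relation.Unary using (Pred; _∈_)

-- Boolean and syntactic preliminaries.

∧-intro : ∀ {x y} → x ≡ true → y ≡ true → x Bool.∧ y ≡ true
∧-intro refl refl = refl

∧-elim : ∀ x {y} → x Bool.∧ y ≡ true → x ≡ true × y ≡ true
∧-elim true eq = refl , eq

∨-elim : ∀ x {y} → x Bool.∨ y ≡ true → x ≡ true ⊎ y ≡ true
∨-elim true  eq = inj₁ refl
∨-elim false eq = inj₂ eq

⊃-intro : ∀ x {y} → (x ≡ true → y ≡ true) → x ⊃ y ≡ true
⊃-intro true  f = f refl
⊃-intro false f = refl

≤-true : ∀ {x y} → x Bool.≤ y → x ≡ true → y ≡ true
≤-true b≤b eq = eq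

prefixMeet-false : ∀ {m} (z : Vec Bool m) i j → i Fin.≤ j →
                   lookup z i ≡ false → prefixMeet z j ≡ false
prefixMeet-false (x ∷ z) zero    zero    i≤j       eq = eq
prefixMeet-false (x ∷ z) zero    (suc j) i≤j       refl = refl
prefixMeet-false (x ∷ z) (suc i) (suc j) (s≤s i≤j) eq =
  trans (cong (x Bool.∧_) (prefixMeet-false z i j i≤j eq)) (Boolₚ.∧-zeroʳ x)

-- Serves the induction in `t⇒⊮αᵏ`, which replaces `α` by `α ^ 1` at each step.
α¹^k : ∀ α k → (α ^ 1) ^ k ≡ α ^ suc k
α¹^k α zero    = refl
α¹^k α (suc k) = cong (λ β → ¬ (β ∧ ¬ β)) (α¹^k α k)

-- Truth values and multioperations.

module TruthValues (n : ℕ) (2≤n : 2 ≤ n) where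
  open Swap n 2≤n

  private variable
    a c z : Tuple
    p : ℕ

  -- A 0 at `i` makes the meet of all entries before `j` equal to 0, so membership in `A` forces
  -- entry `j` to be 1.
  no-two-zeros : ∀ z → z ∈ A → ∀ i j → i Fin.< j →
                 lookup z i ≡ false → lookup z j ≡ false → ⊥
  no-two-zeros z z∈A i (suc j) (s≤s i≤j) zᵢ zⱼ = contradiction (z∈A j)
    (λ eq → contradiction (trans (sym eq) (cong₂ Bool._∨_ meet zⱼ)) λ ())
    where
    meet : prefixMeet z (inject₁ j) ≡ false
    meet = prefixMeet-false z i (inject₁ j)
      (subst (toℕ i ≤_) (sym (Finₚ.toℕ-inject₁ j)) i≤j) zᵢ

  zero-unique : ∀ z → z ∈ A → ∀ i j → lookup z i ≡ false → lookup z j ≡ false → i ≡ j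
  zero-unique z z∈A i j zᵢ zⱼ with Finₚ.<-cmp i j
  ... | tri< i<j _ _ = ⊥-elim (no-two-zeros z z∈A i j i<j zᵢ zⱼ)
  ... | tri≈ _ i≡j _ = i≡j
  ... | tri> _ _ j<i = ⊥-elim (no-two-zeros z z∈A j i j<i zⱼ zᵢ)

  ≡zeroAt : (∀ i → lookup z i ≡ not (toℕ i ≡ᵇ p)) → z ≡ zeroAt p
  ≡zeroAt {z} eq = trans (sym (Vecₚ.tabulate∘lookup z)) (Vecₚ.tabulate-cong eq)

  ≢⇒≡ᵇ-false : ∀ {i j} → i ≢ j → (i ≡ᵇ j) ≡ false
  ≢⇒≡ᵇ-false {i} {j} i≢j = Boolₚ.¬-not
    λ eq → i≢j (ℕₚ.≡ᵇ⇒≡ i j (subst Bool.T (sym eq) _))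

  ≡ᵇ-refl : ∀ i → (i ≡ᵇ i) ≡ true
  ≡ᵇ-refl zero    = refl
  ≡ᵇ-refl (suc i) = ≡ᵇ-refl i

  zeroAt-lookup : ∀ z → z ∈ A → ∀ i → lookup z i ≡ false → z ≡ zeroAt (toℕ i)
  zeroAt-lookup z z∈A i zᵢ = ≡zeroAt eq
    where
    eq : ∀ j → lookup z j ≡ not (toℕ j ≡ᵇ toℕ i)
    eq j with j Finₚ.≟ i
    ... | yes refl = trans zᵢ (cong not (sym (≡ᵇ-refl (toℕ i))))
    ... | no  j≢i  = trans (Boolₚ.¬-not λ zⱼ → j≢i (zero-unique z z∈A j i zⱼ zᵢ))
                           (cong not (sym (≢⇒≡ᵇ-false (j≢i ∘ Finₚ.toℕ-injective))))

  zeroAt-all : ∀ z → z ∈ A → ∃[ p ] (p ≤ suc n × z ≡ zeroAt p)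
  zeroAt-all z z∈A with Finₚ.any? (λ i → lookup z i Boolₚ.≟ false)
  ... | yes (i , zᵢ) = toℕ i , ℕₚ.<⇒≤ (Finₚ.toℕ<n i) , zeroAt-lookup z z∈A i zᵢ
  -- Indices stop at `n`, so `zeroAt (suc n)` is the all-ones tuple.
  ... | no  none     = suc n , ℕₚ.≤-refl , ≡zeroAt λ i →
    trans (Boolₚ.¬-not λ zᵢ → none (i , zᵢ))
          (cong not (sym (≢⇒≡ᵇ-false (ℕₚ.<⇒≢ (Finₚ.toℕ<n i)))))

  -- Position 0 gives `F`, position 1 gives `T`, and position `k + 2` gives `t k`; the range of
  -- positions yields the bound on `k` that `v-tₖ` asks for.
  Boo-or-t : ∀ z → z ∈ A → z ∈ Boo ⊎ ∃[ k ] (k ≤ n ∸ 1 × z ≡ t k)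
  Boo-or-t z z∈A with zeroAt-all z z∈A
  ... | zero        , _         , z≡F = inj₁ (inj₂ (sym z≡F))
  ... | suc zero    , _         , z≡T = inj₁ (inj₁ (sym z≡T))
  ... | suc (suc k) , s≤s 1+k≤n , z≡t = inj₂ (k , ℕₚ.∸-monoˡ-≤ 1 1+k≤n , z≡t)

  π₂-zeroAt : ∀ p → π₂ (zeroAt p) ≡ not (1 ≡ᵇ p)
  π₂-zeroAt p = trans
    (Vecₚ.lookup∘tabulate (λ i → not (toℕ i ≡ᵇ p)) (Fin.fromℕ< (ℕₚ.m≤n⇒m≤1+n 2≤n)))
    (cong (λ i → not (i ≡ᵇ p)) (Finₚ.toℕ-fromℕ< (ℕₚ.m≤n⇒m≤1+n 2≤n)))

  π₁-false⇒≡F : ∀ z → z ∈ A → π₁ z ≡ false → z ≡ F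
  π₁-false⇒≡F z z∈A = zeroAt-lookup z z∈A zero

  π₂-false⇒≡T : ∀ z → z ∈ A → π₂ z ≡ false → z ≡ T
  π₂-false⇒≡T z z∈A eq = trans (zeroAt-lookup z z∈A _ eq)
    (cong zeroAt (Finₚ.toℕ-fromℕ< (ℕₚ.m≤n⇒m≤1+n 2≤n)))

  Boo∧π₁⇒≡T : z ∈ Boo → π₁ z ≡ true → z ≡ T
  Boo∧π₁⇒≡T (inj₁ refl) _ = refl
  Boo∧π₁⇒≡T (inj₂ refl) ()

  π₁-true⇒D : z ∈ A → π₁ z ≡ true → z ∈ D
  π₁-true⇒D z∈A eq = z∈A , λ { refl → contradiction eq λ () }

  D⇒π₁-true : z ∈ D → π₁ z ≡ true
  D⇒π₁-true {z} (z∈A , z≢F) = Boolₚ.¬-not λ eq → z≢F (sym (π₁-false⇒≡F z z∈A eq))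

  -- On `T` the first coordinate of `c` must be 0, which leaves only `F`; on `F` the second must be
  -- 0, which leaves only `T`.
  ¬̃-Boo : a ∈ Boo → c ∈ ¬̃ a → c ∈ Boo
  ¬̃-Boo (inj₁ refl) (c∈A , c₁ , _) =
    inj₂ (sym (π₁-false⇒≡F _ c∈A (trans c₁ (π₂-zeroAt 1))))
  ¬̃-Boo (inj₂ refl) (c∈A , _ , c₂≤) =
    inj₁ (sym (π₂-false⇒≡T _ c∈A (Boolₚ.¬-not λ c₂ → contradiction (≤-true c₂≤ c₂) λ ())))

  -- Both branches of the conditional in `binary` put the same constraint on the first coordinate;
  -- the case split only lets it reduce.
  binary-π₁ : ∀ _*_ a b {c} → c ∈ binary _*_ a b → π₁ c ≡ (π₁ a * π₁ b)
  binary-π₁ _*_ a b h with Boo? a | Boo? b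
  ... | yes _ | yes _ = proj₂ h
  ... | yes _ | no  _ = proj₂ h
  ... | no  _ | yes _ = proj₂ h
  ... | no  _ | no  _ = proj₂ h

  binary-Boo : ∀ _*_ {a b c} → a ∈ Boo → b ∈ Boo → c ∈ binary _*_ a b → c ∈ Boo
  binary-Boo _*_ {a} {b} a∈Boo b∈Boo h with Boo? a | Boo? b
  ... | yes _ | yes _ = proj₁ h
  ... | yes _ | no  ¬b = contradiction b∈Boo ¬b
  ... | no ¬a | _      = contradiction a∈Boo ¬a

-- Truth at a world of a model.

module Soundness (n : ℕ) (2≤n : 2 ≤ n) {w r : Level} (M : Swap.Model n 2≤n w r) where
  open Swap n 2≤n
  open Model M
  open TruthValues n 2≤n

  private variable
    α β : Formula

  infix 4 _⊩_

  -- Designation as a Boolean equation; `D` itself enters only in the final theorem.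
  _⊩_ : World → Formula → Set
  u ⊩ α = π₁ (v u α) ≡ true

  ∧-homo : ∀ u α β → π₁ (v u (α ∧ β)) ≡ π₁ (v u α) Bool.∧ π₁ (v u β)
  ∧-homo u α β = binary-π₁ Bool._∧_ (v u α) (v u β) (v-∧ u α β)

  ∨-homo : ∀ u α β → π₁ (v u (α ∨ β)) ≡ π₁ (v u α) Bool.∨ π₁ (v u β)
  ∨-homo u α β = binary-π₁ Bool._∨_ (v u α) (v u β) (v-∨ u α β)

  ⇒-homo : ∀ u α β → π₁ (v u (α ⇒ β)) ≡ π₁ (v u α) ⊃ π₁ (v u β)
  ⇒-homo u α β = binary-π₁ _⊃_ (v u α) (v u β) (v-⇒ u α β)

  module _ {u : World} where

    ∧I : u ⊩ α → u ⊩ β → u ⊩ α ∧ β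
    ∧I x y = trans (∧-homo u _ _) (∧-intro x y)

    ∧E : u ⊩ α ∧ β → u ⊩ α × u ⊩ β
    ∧E x = ∧-elim _ (trans (sym (∧-homo u _ _)) x)

    ∨I₁ : u ⊩ α → u ⊩ α ∨ β
    ∨I₁ x = trans (∨-homo u _ _) (cong (Bool._∨ _) x)

    ∨I₂ : u ⊩ β → u ⊩ α ∨ β
    ∨I₂ y = trans (∨-homo u _ _) (trans (cong (_ Bool.∨_) y) (Boolₚ.∨-zeroʳ _))

    ∨E : u ⊩ α ∨ β → u ⊩ α ⊎ u ⊩ β
    ∨E x = ∨-elim _ (trans (sym (∨-homo u _ _)) x)

    ⇒I : (u ⊩ α → u ⊩ β) → u ⊩ α ⇒ β
    ⇒I f = trans (⇒-homo u _ _) (⊃-intro _ f)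

    ⇒E : u ⊩ α ⇒ β → u ⊩ α → u ⊩ β
    ⇒E f x = trans (cong (_⊃ _) (sym x)) (trans (sym (⇒-homo u _ _)) f)

    ⊩-dec : ∀ α → u ⊩ α ⊎ (u ⊩ α → ⊥)
    ⊩-dec α with π₁ (v u α)
    ... | true  = inj₁ refl
    ... | false = inj₂ λ ()

    ⊮⇒≡F : (u ⊩ α → ⊥) → v u α ≡ F
    ⊮⇒≡F {α} u⊮α = π₁-false⇒≡F _ (v∈A u α) (Boolₚ.¬-not u⊮α)

    ≡F⇒⊩¬ : v u α ≡ F → u ⊩ ¬ α
    ≡F⇒⊩¬ {α} eq = trans (proj₁ (proj₂ (v-¬ u α))) (trans (cong π₂ eq) (π₂-zeroAt 0))

    ≡T⇒⊮¬ : v u α ≡ T → u ⊩ ¬ α → ⊥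
    ≡T⇒⊮¬ {α} eq x = contradiction
      (trans (sym x) (trans (proj₁ (proj₂ (v-¬ u α))) (trans (cong π₂ eq) (π₂-zeroAt 1)))) λ ()

    -- The first coordinate of `¬ ¬ α` is the second of `¬ α`, which is at most the first of `α`.
    ¬¬E : u ⊩ ¬ ¬ α → u ⊩ α
    ¬¬E {α} x = ≤-true (proj₂ (proj₂ (v-¬ u α)))
      (trans (sym (proj₁ (proj₂ (v-¬ u (¬ α))))) x)

    Boo⇒consistent : v u α ∈ Boo → u ⊩ α → u ⊩ ¬ α → ⊥
    Boo⇒consistent α∈Boo x = ≡T⇒⊮¬ (Boo∧π₁⇒≡T α∈Boo x)

    -- The contradiction `α ∧ ¬ α` is not true, so it has value `F`; its negation is then true and
    -- in `Boo`, hence `T`.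
    Boo⇒α¹≡T : v u α ∈ Boo → v u (α ^ 1) ≡ T
    Boo⇒α¹≡T {α} α∈Boo = Boo∧π₁⇒≡T (¬̃-Boo α∧¬α∈Boo (v-¬ u _)) (≡F⇒⊩¬ (⊮⇒≡F
      λ x → Boo⇒consistent α∈Boo (proj₁ (∧E x)) (proj₂ (∧E x))))
      where
      α∧¬α∈Boo : v u (α ∧ ¬ α) ∈ Boo
      α∧¬α∈Boo = binary-Boo Bool._∧_ α∈Boo (¬̃-Boo α∈Boo (v-¬ u α)) (v-∧ u _ _)

    Boo⇒αᵏ≡T : v u α ∈ Boo → ∀ k → v u (α ^ suc k) ≡ T
    Boo⇒αᵏ≡T α∈Boo zero    = Boo⇒α¹≡T α∈Boo
    -- The next power is by definition `(α ^ suc k) ^ 1`, and `T` is again in `Boo`.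
    Boo⇒αᵏ≡T α∈Boo (suc k) = Boo⇒α¹≡T (inj₁ (sym (Boo⇒αᵏ≡T α∈Boo k)))

    -- Induction on `k`: `v-tₖ` gives `α ^ 1` the value with index one lower, and at index 0 `v-t₀`
    -- makes `α ∧ ¬ α` equal to `T`, so its negation fails.
    t⇒⊮αᵏ : ∀ k → k ≤ n ∸ 1 → v u α ≡ t k → u ⊩ α ^ suc k → ⊥
    t⇒⊮αᵏ {α} zero    _   eq = ≡T⇒⊮¬ (v-t₀ u α eq)
    t⇒⊮αᵏ {α} (suc k) k<n eq = t⇒⊮αᵏ k (ℕₚ.<⇒≤ k<n)
      (proj₂ (v-tₖ u α (suc k) (s≤s z≤n) k<n eq)) ∘ subst (u ⊩_) (sym (α¹^k α (suc k)))

    ⁽⁾I : ∀ m → (∀ k → u ⊩ α ^ suc k) → u ⊩ α ⁽ m ⁾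
    ⁽⁾I zero          f = f 0
    ⁽⁾I (suc zero)    f = f 0
    ⁽⁾I (suc (suc m)) f = ∧I (⁽⁾I (suc m) f) (f (suc m))

    ⁽⁾E : ∀ m → u ⊩ α ⁽ m ⁾ → ∀ k → k < m → u ⊩ α ^ suc k
    ⁽⁾E (suc zero)    x zero k<m = x
    ⁽⁾E (suc zero)    x (suc k) (s≤s ())
    ⁽⁾E (suc (suc m)) x k (s≤s k≤m) =
      [ ⁽⁾E (suc m) (proj₁ (∧E x)) k , (λ { refl → proj₂ (∧E x) }) ]′ (ℕₚ.m≤n⇒m<n∨m≡n k≤m)

    Boo⇒⊩⁽ⁿ⁾ : v u α ∈ Boo → u ⊩ α ⁽ n ⁾
    Boo⇒⊩⁽ⁿ⁾ α∈Boo = ⁽⁾I n λ k → cong π₁ (Boo⇒αᵏ≡T α∈Boo k)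

    -- A value `t k` would refute `α ^ suc k`, which is one of the `n` conjuncts because `k < n`.
    ⊩⁽ⁿ⁾⇒Boo : u ⊩ α ⁽ n ⁾ → v u α ∈ Boo
    ⊩⁽ⁿ⁾⇒Boo {α} x with Boo-or-t (v u α) (v∈A u α)
    ... | inj₁ α∈Boo            = α∈Boo
    ... | inj₂ (k , k≤n∸1 , eq) = ⊥-elim (t⇒⊮αᵏ k k≤n∸1 eq (⁽⁾E n x k k<n))
      where
      k<n : k < n
      k<n = ℕₚ.≤-trans (s≤s k≤n∸1) (ℕₚ.≤-reflexive (ℕₚ.m+[n∸m]≡n (ℕₚ.<⇒≤ 2≤n)))

    ∼I : (u ⊩ α → ⊥) → u ⊩ ∼[ n ] α
    ∼I u⊮α = ∧I (≡F⇒⊩¬ (⊮⇒≡F u⊮α)) (Boo⇒⊩⁽ⁿ⁾ (inj₂ (sym (⊮⇒≡F u⊮α))))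

    ∼E : u ⊩ ∼[ n ] α → u ⊩ α → ⊥
    ∼E x y = Boo⇒consistent (⊩⁽ⁿ⁾⇒Boo (proj₂ (∧E x))) y (proj₁ (∧E x))

    OI : (∀ {u′} → u R u′ → u′ ⊩ α) → u ⊩ O α
    -- `true` is a lower bound of the values at successors, so it lies below their greatest lower
    -- bound.
    OI {α} f = ≤-true (proj₂ (proj₂ (v-O u α)) true
      λ { (_ , (_ , uRu′ , refl) , refl) → Boolₚ.≤-reflexive (sym (f uRu′)) }) refl

    OE : u ⊩ O α → ∀ {u′} → u R u′ → u′ ⊩ α
    OE {α} x uRu′ = ≤-true (proj₁ (proj₂ (v-O u α)) (_ , (_ , uRu′ , refl) , refl)) x

  -- Validity of axioms and theorems.

  ⊩-axiom : ∀ {α} → Axiom n α → ∀ u → u ⊩ α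
  ⊩-axiom (ax-K α β)   u = ⇒I λ x → ⇒I λ _ → x
  ⊩-axiom (ax-S α β γ) u = ⇒I λ f → ⇒I λ g → ⇒I λ x → ⇒E (⇒E f x) (⇒E g x)
  ⊩-axiom (ax-∧I α β)  u = ⇒I λ x → ⇒I λ y → ∧I x y
  ⊩-axiom (ax-∧E₁ α β) u = ⇒I (proj₁ ∘ ∧E)
  ⊩-axiom (ax-∧E₂ α β) u = ⇒I (proj₂ ∘ ∧E)
  ⊩-axiom (ax-∨I₁ α β) u = ⇒I ∨I₁
  ⊩-axiom (ax-∨I₂ α β) u = ⇒I ∨I₂
  ⊩-axiom (ax-∨E α β γ) u = ⇒I λ f → ⇒I λ g → ⇒I λ x → [ ⇒E f , ⇒E g ]′ (∨E x)
  ⊩-axiom (ax-∨⇒ α β)  u = [ ∨I₁ , (λ u⊮α → ∨I₂ (⇒I (⊥-elim ∘ u⊮α))) ]′ (⊩-dec α)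
  ⊩-axiom (ax-EM α)    u = [ ∨I₁ , ∨I₂ ∘ ≡F⇒⊩¬ ∘ ⊮⇒≡F ]′ (⊩-dec α)
  ⊩-axiom (ax-cf α)    u = ⇒I ¬¬E
  ⊩-axiom (ax-bc α β)  u = ⇒I λ x → ⇒I λ y → ⇒I λ z →
    ⊥-elim (Boo⇒consistent (⊩⁽ⁿ⁾⇒Boo x) y z)
  ⊩-axiom (ax-P α β)   u = ⇒I λ x →
    let α∈Boo = ⊩⁽ⁿ⁾⇒Boo (proj₁ (∧E x))
        β∈Boo = ⊩⁽ⁿ⁾⇒Boo (proj₂ (∧E x))
    in ∧I (∧I (Boo⇒⊩⁽ⁿ⁾ (binary-Boo _⊃_     α∈Boo β∈Boo (v-⇒ u α β)))
              (Boo⇒⊩⁽ⁿ⁾ (binary-Boo Bool._∨_ α∈Boo β∈Boo (v-∨ u α β))))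
          (Boo⇒⊩⁽ⁿ⁾ (binary-Boo Bool._∧_ α∈Boo β∈Boo (v-∧ u α β)))
  ⊩-axiom (ax-OK α β)  u = ⇒I λ f → ⇒I λ x → OI λ uRu′ → ⇒E (OE f uRu′) (OE x uRu′)
  -- Seriality supplies a successor, at which `α` and `∼[ n ] α` would both hold.
  ⊩-axiom (ax-OD α)    u = ⇒I λ x → ∼I λ y →
    let _ , uRu′ = serial u in ∼E (OE y uRu′) (OE x uRu′)
  ⊩-axiom (ax-PO α)    u = ⇒I λ x → Boo⇒⊩⁽ⁿ⁾ (v-Boo u α (⊩⁽ⁿ⁾⇒Boo x))

  -- The world varies in the induction, since `nec` uses its premise at the successors of `u`.
  ⊩-theorem : ∀ {α} → Theorem n α → ∀ u → u ⊩ α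
  ⊩-theorem (axiom a) u = ⊩-axiom a u
  ⊩-theorem (mp f x)  u = ⇒E (⊩-theorem f u) (⊩-theorem x u)
  ⊩-theorem (nec x)   u = OI λ {u′} _ → ⊩-theorem x u′

  -- The fold brackets to the left, so the head `γ` acts as accumulator and absorbs one conjunct per
  -- step.
  ⊩-⋀⁺ : ∀ {u γ} γs → u ⊩ γ → List.All (u ⊩_) γs → u ⊩ ⋀⁺ (γ ∷ γs)
  ⊩-⋀⁺ []       x []       = x
  ⊩-⋀⁺ (_ ∷ γs) x (y ∷ ys) = ⊩-⋀⁺ γs (∧I x y) ys

theorem7p12 : ∀ {w r ℓ : Level} (n : ℕ) (2≤n : 2 ≤ n) (Γ : Pred Formula ℓ) (φ : Formula) → Γ ⊢[ n ] φ → Swap.Entails n 2≤n w r Γ φ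
theorem7p12 n 2≤n Γ φ Γ⊢φ M u u⊨Γ = π₁-true⇒D (v∈A u φ) (u⊩φ Γ⊢φ)
  where
  open Swap.Model M
  open TruthValues n 2≤n
  open Soundness n 2≤n M

  u⊩φ : Γ ⊢[ n ] φ → u ⊩ φ
  u⊩φ (inj₁ ⊢φ) = ⊩-theorem ⊢φ u
  u⊩φ (inj₂ (γ ∷ γs , γ∈Γ ∷ γs⊆Γ , ⊢γs⇒φ)) = ⇒E (⊩-theorem ⊢γs⇒φ u)
    (⊩-⋀⁺ γs (D⇒π₁-true (u⊨Γ γ∈Γ)) (List.map (D⇒π₁-true ∘ u⊨Γ) γs⊆Γ))
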